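{- QHC is a strongly conservative extension of intuitionistic predicate calculus QH: if $\alpha_1,\dots,\alpha_n,\alpha$ are problems built from atomic problems and $\bot$ using only intuitionistic connectives and quantifiers (no $!$, $?$), and $\alpha_1,\dots,\alpha_n\vdash_{\mathrm{QHC}}\alpha$, then $\alpha_1,\dots,\alpha_n\vdash_{\mathrm{QH}}\alpha$.
   Context: QHC is a two-sorted first-order calculus. Its only terms are individual variables. Every formula is either a problem (denoted by Greek letters $\alpha,\beta,\gamma,\dots$) or a proposition (denoted by Latin letters $p,q,\dots$). Atomic formulas are proposition variables $p(t_1,\dots,t_n)$ (of proposition type), problem variables $\pi(t_1,\dots,t_n)$ (of problem type), and the constants $0$ (a proposition, classical falsity) and $\bot$ (a problem, intuitionistic absurdity). Propositions are closed under the classical connectives $\land,\lor,\to$ and quantifiers $\exists,\forall$; problems are closed under the intuitionistic connectives $\land,\lor,\to$ and quantifiers $\exists,\forall$ (the same symbols are used, distinguished by the type of the arguments). $\neg p$ abbreviates $p\to 0$, $\neg\alpha$ abbreviates $\alpha\to\bot$, and $\leftrightarrow$ is defined as usual. There are two type-conversion operators: if $p$ is a proposition then $!p$ is a problem, and if $\alpha$ is a problem then $?\alpha$ is a proposition. Deductive system of QHC: all axioms and rules of classical predicate logic applied to all propositions; all postulates and rules of intuitionistic predicate logic applied to all problems; the rules $p\,/\,!p$ and $\alpha\,/\,?\alpha$; and the schemas $?!p\to p$; $\alpha\to\, !?\alpha$; $!(p\to q)\to(!p\to !q)$; $?(\alpha\to\beta)\to(?\alpha\to ?\beta)$; $!0\to\bot$;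 $?(\alpha\land\beta)\leftrightarrow ?\alpha\land ?\beta$; $?(\alpha\lor\beta)\leftrightarrow ?\alpha\lor ?\beta$; $?\bot\to 0$; $?\exists x\,\alpha(x)\leftrightarrow\exists x\,?\alpha(x)$; $?\forall x\,\alpha(x)\to\forall x\,?\alpha(x)$ (usual variable side conditions implicit). $\vdash A$ means $A$ is derivable in QHC; $A\Rightarrow B$ means $\vdash A\to B$ and $A\Leftrightarrow B$ means $\vdash A\leftrightarrow B$ (with $A,B$ of the same type); $A\vdash B$ means $B$ is derivable in QHC from the premise $A$. Notation: $\Box p := ?!p$ (a proposition) and $\nabla\alpha := !?\alpha$ (a problem). QC and QH denote classical and intuitionistic predicate calculus. -}

module Defs where

open import Data.Bool using (if_then_else_)
open import Data.Empty using (⊥)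
open import Data.List using (List; map)
open import Data.List.Membership.Propositional using (_∈_)
open import Data.Nat using (ℕ; _≡ᵇ_)
open import Data.Product using (∃; _×_; _,_)
open import Data.Sum using (_⊎_)
open import Data.Unit using (⊤)
open import Data.Vec as Vec using (Vec)
import Data.Vec.Membership.Propositional as Vecᵐ
open import Relation.Binary.PropositionalEquality using (_≢_)
open import Relation.Nullary using (¬_)

data Sort : Set where
  problem proposition : Sort

-- The plain language lacks the type conversion operators, so its problems are
-- exactly the formulas of QH.  The mixed language is that of QHC.
data Language : Set where
  plain mixed : Language

Var : Set
Var = ℕ

infix  9 !_ ¿_ ~_
infixr 7 _∧_
infixr 6 _∨_
infixr 5 _⊃_
infix  4 _⇔_

-- The two sorts share the symbols for connectives and quantifiers.  For each
-- sort and each arity there are countably many predicate letters, numbered by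
-- ℕ: `atom` gives proposition variables at sort proposition and problem
-- variables at sort problem.  `falsum` is 0 at sort proposition and ⊥ at sort
-- problem.  `¿` is the operator ?, whose usual symbol is reserved in Agda.
data Form : Language → Sort → Set where
  atom        : ∀ {L s n} → ℕ → Vec Var n → Form L s
  falsum      : ∀ {L s} → Form L s
  _∧_ _∨_ _⊃_ : ∀ {L s} → Form L s → Form L s → Form L s
  all ex      : ∀ {L s} → Var → Form L s → Form L s
  !_          : Form mixed proposition → Form mixed problem
  ¿_          : Form mixed problem → Form mixed proposition

~_ : ∀ {L s} → Form L s → Form L s
~ A = A ⊃ falsum

_⇔_ : ∀ {L s} → Form L s → Form L s → Form L s
A ⇔ B = (A ⊃ B) ∧ (B ⊃ A)

_FreeIn_ : ∀ {L s} → Var → Form L s → Set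
x FreeIn atom _ ts = x Vecᵐ.∈ ts
x FreeIn falsum    = ⊥
x FreeIn (A ∧ B)   = x FreeIn A ⊎ x FreeIn B
x FreeIn (A ∨ B)   = x FreeIn A ⊎ x FreeIn B
x FreeIn (A ⊃ B)   = x FreeIn A ⊎ x FreeIn B
x FreeIn all y A   = x ≢ y × x FreeIn A
x FreeIn ex y A    = x ≢ y × x FreeIn A
x FreeIn (! A)     = x FreeIn A
x FreeIn (¿ A)     = x FreeIn A

-- Replaces the free occurrences of x by t without renaming bound variables;
-- meaningful only under `FreeFor t x A`.
_[_≔_] : ∀ {L s} → Form L s → Var → Var → Form L s
atom P ts [ x ≔ t ] = atom P (Vec.map (λ y → if y ≡ᵇ x then t else y) ts)
falsum    [ x ≔ t ] = falsum
(A ∧ B)   [ x ≔ t ] = A [ x ≔ t ] ∧ B [ x ≔ t ]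
(A ∨ B)   [ x ≔ t ] = A [ x ≔ t ] ∨ B [ x ≔ t ]
(A ⊃ B)   [ x ≔ t ] = A [ x ≔ t ] ⊃ B [ x ≔ t ]
all y A   [ x ≔ t ] = all y (if y ≡ᵇ x then A else A [ x ≔ t ])
ex y A    [ x ≔ t ] = ex y (if y ≡ᵇ x then A else A [ x ≔ t ])
(! A)     [ x ≔ t ] = ! (A [ x ≔ t ])
(¿ A)     [ x ≔ t ] = ¿ (A [ x ≔ t ])

-- No free occurrence of x in A lies in the scope of a quantifier binding t.
FreeFor : ∀ {L s} → Var → Var → Form L s → Set
FreeFor t x (atom _ _) = ⊤
FreeFor t x falsum     = ⊤
FreeFor t x (A ∧ B)    = FreeFor t x A × FreeFor t x B
FreeFor t x (A ∨ B)    = FreeFor t x A × FreeFor t x B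
FreeFor t x (A ⊃ B)    = FreeFor t x A × FreeFor t x B
FreeFor t x (all y A)  = ¬ (x FreeIn all y A) ⊎ (t ≢ y × FreeFor t x A)
FreeFor t x (ex y A)   = ¬ (x FreeIn ex y A) ⊎ (t ≢ y × FreeFor t x A)
FreeFor t x (! A)      = FreeFor t x A
FreeFor t x (¿ A)      = FreeFor t x A

-- Hilbert-style axiom schemas of intuitionistic predicate logic.
data IntAxiom {L s} : Form L s → Set where
  K       : ∀ A B   → IntAxiom (A ⊃ B ⊃ A)
  S       : ∀ A B C → IntAxiom ((A ⊃ B ⊃ C) ⊃ (A ⊃ B) ⊃ A ⊃ C)
  ∧-intro : ∀ A B   → IntAxiom (A ⊃ B ⊃ A ∧ B)
  ∧-elim₁ : ∀ A B   → IntAxiom (A ∧ B ⊃ A)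
  ∧-elim₂ : ∀ A B   → IntAxiom (A ∧ B ⊃ B)
  ∨-intro₁ : ∀ A B  → IntAxiom (A ⊃ A ∨ B)
  ∨-intro₂ : ∀ A B  → IntAxiom (B ⊃ A ∨ B)
  ∨-elim  : ∀ A B C → IntAxiom ((A ⊃ C) ⊃ (B ⊃ C) ⊃ A ∨ B ⊃ C)
  ex-falso : ∀ A    → IntAxiom (falsum ⊃ A)
  ∀-inst  : ∀ x t A → FreeFor t x A → IntAxiom (all x A ⊃ A [ x ≔ t ])
  ∃-wit   : ∀ x t A → FreeFor t x A → IntAxiom (A [ x ≔ t ] ⊃ ex x A)
  ∀-dist  : ∀ x A B → ¬ (x FreeIn B) → IntAxiom (all x (B ⊃ A) ⊃ B ⊃ all x A)
  ∃-dist  : ∀ x A B → ¬ (x FreeIn B) → IntAxiom (all x (A ⊃ B) ⊃ ex x A ⊃ B)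

-- Both consequence relations treat the premises as additional axioms: every
-- rule, including generalisation and the two conversion rules, may be applied
-- to formulas that depend on them.

infix 3 _⊢QH_ _⊢QHC_

data _⊢QH_ (Γ : List (Form plain problem)) : Form plain problem → Set where
  premise : ∀ {α}   → α ∈ Γ → Γ ⊢QH α
  axiom   : ∀ {α}   → IntAxiom α → Γ ⊢QH α
  mp      : ∀ {α β} → Γ ⊢QH α ⊃ β → Γ ⊢QH α → Γ ⊢QH β
  gen     : ∀ {α} x → Γ ⊢QH α → Γ ⊢QH all x α

-- Classical logic of propositions is `IntAxiom` at sort proposition together
-- with excluded middle.
data QHCAxiom : ∀ {s} → Form mixed s → Set where
  int     : ∀ {s} {A : Form mixed s} → IntAxiom A → QHCAxiom A
  lem     : (p : Form mixed proposition) → QHCAxiom (p ∨ ~ p)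
  ¿!-elim : ∀ p   → QHCAxiom (¿ ! p ⊃ p)
  !¿-intro : ∀ α  → QHCAxiom (α ⊃ ! ¿ α)
  !-⊃     : ∀ p q → QHCAxiom (! (p ⊃ q) ⊃ ! p ⊃ ! q)
  ¿-⊃     : ∀ α β → QHCAxiom (¿ (α ⊃ β) ⊃ ¿ α ⊃ ¿ β)
  !-0     : QHCAxiom (! falsum ⊃ falsum)
  ¿-∧     : ∀ α β → QHCAxiom (¿ (α ∧ β) ⇔ ¿ α ∧ ¿ β)
  ¿-∨     : ∀ α β → QHCAxiom (¿ (α ∨ β) ⇔ ¿ α ∨ ¿ β)
  ¿-⊥     : QHCAxiom (¿ falsum ⊃ falsum)
  ¿-∃     : ∀ x α → QHCAxiom (¿ (ex x α) ⇔ ex x (¿ α))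
  ¿-∀     : ∀ x α → QHCAxiom (¿ (all x α) ⊃ all x (¿ α))

data _⊢QHC_ (Γ : List (∃ (Form mixed))) : ∀ {s} → Form mixed s → Set where
  premise : ∀ {s} {A : Form mixed s} → (s , A) ∈ Γ → Γ ⊢QHC A
  axiom   : ∀ {s} {A : Form mixed s} → QHCAxiom A → Γ ⊢QHC A
  mp      : ∀ {s} {A B : Form mixed s} → Γ ⊢QHC A ⊃ B → Γ ⊢QHC A → Γ ⊢QHC B
  gen     : ∀ {s} {A : Form mixed s} x → Γ ⊢QHC A → Γ ⊢QHC all x A
  !-rule  : ∀ {p} → Γ ⊢QHC p → Γ ⊢QHC ! p
  ¿-rule  : ∀ {α} → Γ ⊢QHC α → Γ ⊢QHC ¿ α

embed : ∀ {s} → Form plain s → Form mixed s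
embed (atom P ts) = atom P ts
embed falsum      = falsum
embed (A ∧ B)     = embed A ∧ embed B
embed (A ∨ B)     = embed A ∨ embed B
embed (A ⊃ B)     = embed A ⊃ embed B
embed (all x A)   = all x (embed A)
embed (ex x A)    = ex x (embed A)

embedAll : List (Form plain problem) → List (∃ (Form mixed))
embedAll = map (λ α → problem , embed α)

{-# OPTIONS --safe #-}

-- QHC is interpreted in QH by reading propositions as ¬¬-stable problems:
-- `!` is forgotten, `?` becomes ¬¬, and ¬¬ is put in front of atomic
-- propositions and of the classical ∨ and ∃ (the Gödel–Gentzen translation).
-- This turns every derivation in QHC into one in QH and leaves problems without
-- `!` and `?` unchanged.
module Submission where

open import Defs
open import Data.Bool using (true; false; if_then_else_)
open import Data.List using (List; []; _∷_)
open import Data.List.Membership.Propositional using (_∈_)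
open import Data.List.Membership.Propositional.Properties using (∈-map⁻)
open import Data.List.Relation.Unary.Any using (here; there)
open import Data.Nat using (_≡ᵇ_; _≟_)
open import Data.Nat.Properties using (≡ᵇ⇒≡)
open import Data.Product as Product using (_,_; proj₁)
open import Data.Sum as Sum using (inj₁; inj₂; [_,_])
open import Data.Unit using (tt)
import Data.Vec.Properties as Vec
open import Function using (id; _∘_)
open import Relation.Binary.PropositionalEquality using (_≡_; refl; sym; trans; cong; cong₂; subst)
open import Relation.Nullary using (¬_; yes; no)

-- Substitution of a variable for itself

if-self : ∀ x y → (if y ≡ᵇ x then x else y) ≡ y
if-self x y with y ≡ᵇ x | ≡ᵇ⇒≡ y x
... | true  | y≡x = sym (y≡x tt)
... | false | _   = refl

-- With `FreeFor-self`, this turns `∀-inst` and `∃-wit` at t = x into the renaming-free `∀-elim` and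
-- `∃-intro`.
[≔]-self : ∀ {L s} x (A : Form L s) → A [ x ≔ x ] ≡ A
[≔]-self x (atom P ts) = cong (atom P) (trans (Vec.map-cong (if-self x) ts) (Vec.map-id ts))
[≔]-self x falsum      = refl
[≔]-self x (A ∧ B)     = cong₂ _∧_ ([≔]-self x A) ([≔]-self x B)
[≔]-self x (A ∨ B)     = cong₂ _∨_ ([≔]-self x A) ([≔]-self x B)
[≔]-self x (A ⊃ B)     = cong₂ _⊃_ ([≔]-self x A) ([≔]-self x B)
[≔]-self x (all y A) with y ≡ᵇ x
... | true  = refl
... | false = cong (all y) ([≔]-self x A)
[≔]-self x (ex y A) with y ≡ᵇ x
... | true  = refl
... | false = cong (ex y) ([≔]-self x A)
[≔]-self x (! A)       = cong !_ ([≔]-self x A)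
[≔]-self x (¿ A)       = cong ¿_ ([≔]-self x A)

FreeFor-self : ∀ {L s} x (A : Form L s) → FreeFor x x A
FreeFor-self x (atom _ _) = tt
FreeFor-self x falsum     = tt
FreeFor-self x (A ∧ B)    = FreeFor-self x A , FreeFor-self x B
FreeFor-self x (A ∨ B)    = FreeFor-self x A , FreeFor-self x B
FreeFor-self x (A ⊃ B)    = FreeFor-self x A , FreeFor-self x B
FreeFor-self x (all y A) with x ≟ y
... | yes x≡y = inj₁ λ (x≢y , _) → x≢y x≡y
... | no  x≢y = inj₂ (x≢y , FreeFor-self x A)
FreeFor-self x (ex y A) with x ≟ y
... | yes x≡y = inj₁ λ (x≢y , _) → x≢y x≡y
... | no  x≢y = inj₂ (x≢y , FreeFor-self x A)
FreeFor-self x (! A)      = FreeFor-self x A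
FreeFor-self x (¿ A)      = FreeFor-self x A

-- The translation

close : Sort → Form plain problem → Form plain problem
close problem     A = A
close proposition A = ~ ~ A

-- `close` guards the clauses that can break stability; `falsum`, `∧`, `⊃` and `all` preserve it.
-- The argument of `¿` is a problem, possibly unstable, hence the explicit `~ ~`.
⟦_⟧ : ∀ {s} → Form mixed s → Form plain problem
⟦_⟧ {s} (atom P ts) = close s (atom P ts)
⟦ falsum ⟧          = falsum
⟦ A ∧ B ⟧           = ⟦ A ⟧ ∧ ⟦ B ⟧
⟦_⟧ {s} (A ∨ B)     = close s (⟦ A ⟧ ∨ ⟦ B ⟧)
⟦ A ⊃ B ⟧           = ⟦ A ⟧ ⊃ ⟦ B ⟧
⟦ all x A ⟧         = all x ⟦ A ⟧
⟦_⟧ {s} (ex x A)    = close s (ex x ⟦ A ⟧)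
⟦ ! A ⟧             = ⟦ A ⟧
⟦ ¿ A ⟧             = ~ ~ ⟦ A ⟧

-- All subformulas of `embed α` are problems, where `close` is the identity.
⟦embed⟧ : (α : Form plain problem) → ⟦ embed α ⟧ ≡ α
⟦embed⟧ (atom P ts) = refl
⟦embed⟧ falsum      = refl
⟦embed⟧ (A ∧ B)     = cong₂ _∧_ (⟦embed⟧ A) (⟦embed⟧ B)
⟦embed⟧ (A ∨ B)     = cong₂ _∨_ (⟦embed⟧ A) (⟦embed⟧ B)
⟦embed⟧ (A ⊃ B)     = cong₂ _⊃_ (⟦embed⟧ A) (⟦embed⟧ B)
⟦embed⟧ (all x A)   = cong (all x) (⟦embed⟧ A)
⟦embed⟧ (ex x A)    = cong (ex x) (⟦embed⟧ A)

close-[≔] : ∀ s x t A → close s A [ x ≔ t ] ≡ close s (A [ x ≔ t ])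
close-[≔] problem     x t A = refl
close-[≔] proposition x t A = refl

⟦⟧-[≔] : ∀ {s} x t (A : Form mixed s) → ⟦ A [ x ≔ t ] ⟧ ≡ ⟦ A ⟧ [ x ≔ t ]
⟦⟧-[≔] {s} x t (atom P ts) = sym (close-[≔] s x t (atom P ts))
⟦⟧-[≔] x t falsum    = refl
⟦⟧-[≔] x t (A ∧ B)   = cong₂ _∧_ (⟦⟧-[≔] x t A) (⟦⟧-[≔] x t B)
⟦⟧-[≔] {s} x t (A ∨ B) =
  trans (cong (close s) (cong₂ _∨_ (⟦⟧-[≔] x t A) (⟦⟧-[≔] x t B)))
        (sym (close-[≔] s x t (⟦ A ⟧ ∨ ⟦ B ⟧)))
⟦⟧-[≔] x t (A ⊃ B)   = cong₂ _⊃_ (⟦⟧-[≔] x t A) (⟦⟧-[≔] x t B)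
⟦⟧-[≔] x t (all y A) with y ≡ᵇ x
... | true  = refl
... | false = cong (all y) (⟦⟧-[≔] x t A)
⟦⟧-[≔] {s} x t (ex y A) = trans (cong (close s) under) (sym (close-[≔] s x t (ex y ⟦ A ⟧)))
  where
  -- With `s` a variable, `close s` is stuck and hides the test `y ≡ᵇ x` on the right, so the case
  -- split happens inside it.
  under : ex y ⟦ if y ≡ᵇ x then A else A [ x ≔ t ] ⟧ ≡ ex y ⟦ A ⟧ [ x ≔ t ]
  under with y ≡ᵇ x
  ... | true  = refl
  ... | false = cong (ex y) (⟦⟧-[≔] x t A)
⟦⟧-[≔] x t (! A)     = ⟦⟧-[≔] x t A
⟦⟧-[≔] x t (¿ A)     = cong (~_ ∘ ~_) (⟦⟧-[≔] x t A)

~~-FreeIn : ∀ {x} (A : Form plain problem) → x FreeIn (~ ~ A) → x FreeIn A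
~~-FreeIn A = [ [ id , (λ ()) ] , (λ ()) ]

close-FreeIn : ∀ s {x} A → x FreeIn close s A → x FreeIn A
close-FreeIn problem     A = id
close-FreeIn proposition A = ~~-FreeIn A

-- Side conditions mention freeness only negatively, so this inclusion carries them over to
-- translated formulas.
⟦⟧-FreeIn : ∀ {s x} (A : Form mixed s) → x FreeIn ⟦ A ⟧ → x FreeIn A
⟦⟧-FreeIn {s} (atom P ts) = close-FreeIn s (atom P ts)
⟦⟧-FreeIn (A ∧ B)   = Sum.map (⟦⟧-FreeIn A) (⟦⟧-FreeIn B)
⟦⟧-FreeIn {s} (A ∨ B) = Sum.map (⟦⟧-FreeIn A) (⟦⟧-FreeIn B) ∘ close-FreeIn s (⟦ A ⟧ ∨ ⟦ B ⟧)
⟦⟧-FreeIn (A ⊃ B)   = Sum.map (⟦⟧-FreeIn A) (⟦⟧-FreeIn B)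
⟦⟧-FreeIn (all y A) = Product.map₂ (⟦⟧-FreeIn A)
⟦⟧-FreeIn {s} (ex y A) = Product.map₂ (⟦⟧-FreeIn A) ∘ close-FreeIn s (ex y ⟦ A ⟧)
⟦⟧-FreeIn (! A)     = ⟦⟧-FreeIn A
⟦⟧-FreeIn (¿ A)     = ⟦⟧-FreeIn A ∘ ~~-FreeIn ⟦ A ⟧

close-FreeFor : ∀ s {x t} A → FreeFor t x A → FreeFor t x (close s A)
close-FreeFor problem     A f = f
close-FreeFor proposition A f = (f , tt) , tt

⟦⟧-FreeFor : ∀ {s x t} (A : Form mixed s) → FreeFor t x A → FreeFor t x ⟦ A ⟧
⟦⟧-FreeFor {s} (atom P ts) = close-FreeFor s (atom P ts)
⟦⟧-FreeFor falsum    = id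
⟦⟧-FreeFor (A ∧ B)   = Product.map (⟦⟧-FreeFor A) (⟦⟧-FreeFor B)
⟦⟧-FreeFor {s} (A ∨ B) =
  close-FreeFor s (⟦ A ⟧ ∨ ⟦ B ⟧) ∘ Product.map (⟦⟧-FreeFor A) (⟦⟧-FreeFor B)
⟦⟧-FreeFor (A ⊃ B)   = Product.map (⟦⟧-FreeFor A) (⟦⟧-FreeFor B)
⟦⟧-FreeFor (all y A) = Sum.map (_∘ Product.map₂ (⟦⟧-FreeIn A)) (Product.map₂ (⟦⟧-FreeFor A))
⟦⟧-FreeFor {s} (ex y A) =
  close-FreeFor s (ex y ⟦ A ⟧) ∘
  Sum.map (_∘ Product.map₂ (⟦⟧-FreeIn A)) (Product.map₂ (⟦⟧-FreeFor A))
⟦⟧-FreeFor (! A)     = ⟦⟧-FreeFor A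
⟦⟧-FreeFor (¿ A) f   = (⟦⟧-FreeFor A f , tt) , tt

module _ {Γ : List (Form plain problem)} where

  -- Natural deduction in QH

  -- Generalisation is confined to `thm`, so that it never acts on a hypothesis
  -- in Δ and the deduction theorem `lam` holds without side conditions.
  infix 3 _▷_

  data _▷_ (Δ : List (Form plain problem)) : Form plain problem → Set where
    hyp : ∀ {A}   → A ∈ Δ → Δ ▷ A
    thm : ∀ {A}   → Γ ⊢QH A → Δ ▷ A
    app : ∀ {A B} → Δ ▷ A ⊃ B → Δ ▷ A → Δ ▷ B

  lam : ∀ {Δ A B} → A ∷ Δ ▷ B → Δ ▷ A ⊃ B
  lam {A = A} (hyp (here refl)) =
    thm (mp (mp (axiom (S A (A ⊃ A) A)) (axiom (K A (A ⊃ A)))) (axiom (K A A)))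
  lam (hyp (there i)) = app (thm (axiom (K _ _))) (hyp i)
  lam (thm d)         = app (thm (axiom (K _ _))) (thm d)
  lam (app d e)       = app (app (thm (axiom (S _ _ _))) (lam d)) (lam e)

  closed : ∀ {A} → [] ▷ A → Γ ⊢QH A
  closed (thm d)   = d
  closed (app d e) = mp (closed d) (closed e)

  v0 : ∀ {Δ A} → A ∷ Δ ▷ A
  v0 = hyp (here refl)

  v1 : ∀ {Δ A B} → B ∷ A ∷ Δ ▷ A
  v1 = hyp (there (here refl))

  v3 : ∀ {Δ A B C D} → D ∷ C ∷ B ∷ A ∷ Δ ▷ A
  v3 = hyp (there (there (there (here refl))))

  pair : ∀ {Δ A B} → Δ ▷ A → Δ ▷ B → Δ ▷ A ∧ B
  pair d e = app (app (thm (axiom (∧-intro _ _))) d) e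

  fst : ∀ {Δ A B} → Δ ▷ A ∧ B → Δ ▷ A
  fst = app (thm (axiom (∧-elim₁ _ _)))

  snd : ∀ {Δ A B} → Δ ▷ A ∧ B → Δ ▷ B
  snd = app (thm (axiom (∧-elim₂ _ _)))

  inl : ∀ {Δ A B} → Δ ▷ A → Δ ▷ A ∨ B
  inl = app (thm (axiom (∨-intro₁ _ _)))

  inr : ∀ {Δ A B} → Δ ▷ B → Δ ▷ A ∨ B
  inr = app (thm (axiom (∨-intro₂ _ _)))

  ⊃-trans : ∀ {A B C} → Γ ⊢QH A ⊃ B → Γ ⊢QH B ⊃ C → Γ ⊢QH A ⊃ C
  ⊃-trans d e = closed (lam (app (thm e) (app (thm d) v0)))

  ∧-intro-⊢ : ∀ {A B} → Γ ⊢QH A → Γ ⊢QH B → Γ ⊢QH A ∧ B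
  ∧-intro-⊢ d e = mp (mp (axiom (∧-intro _ _)) d) e

  ∀-elim : ∀ x A → Γ ⊢QH all x A ⊃ A
  ∀-elim x A = subst (λ B → Γ ⊢QH all x A ⊃ B) ([≔]-self x A) (axiom (∀-inst x x A (FreeFor-self x A)))

  ∃-intro : ∀ x A → Γ ⊢QH A ⊃ ex x A
  ∃-intro x A = subst (λ B → Γ ⊢QH B ⊃ ex x A) ([≔]-self x A) (axiom (∃-wit x x A (FreeFor-self x A)))

  ∀-intro : ∀ {x A B} → ¬ (x FreeIn B) → Γ ⊢QH B ⊃ A → Γ ⊢QH B ⊃ all x A
  ∀-intro x∉B d = mp (axiom (∀-dist _ _ _ x∉B)) (gen _ d)

  ∃-elim : ∀ {x A B} → ¬ (x FreeIn B) → Γ ⊢QH A ⊃ B → Γ ⊢QH ex x A ⊃ B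
  ∃-elim x∉B d = mp (axiom (∃-dist _ _ _ x∉B)) (gen _ d)

  -- Stability

  Stable : Form plain problem → Set
  Stable A = Γ ⊢QH ~ ~ A ⊃ A

  ~~-intro : ∀ {A} → Γ ⊢QH A ⊃ ~ ~ A
  ~~-intro = closed (lam (lam (app v0 v1)))

  ~-stable : ∀ {A} → Stable (~ A)
  ~-stable = closed (lam (lam (app v1 (app (thm ~~-intro) v0))))

  -- A refutation of `B` pulls back along `A ⊃ B` to a refutation of `A`. Keeping `A ⊃ B` as an
  -- antecedent in the object language lets it depend on hypotheses in Δ.
  ~~-elim : ∀ {A B} → Stable B → Γ ⊢QH (A ⊃ B) ⊃ ~ ~ A ⊃ B
  ~~-elim st = closed (lam (lam (app (thm st) (lam (app v1 (lam (app v1 (app v3 v0))))))))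

  ~~-map : ∀ {A B} → Γ ⊢QH A ⊃ B → Γ ⊢QH ~ ~ A ⊃ ~ ~ B
  ~~-map d = mp (~~-elim ~-stable) (⊃-trans d ~~-intro)

  -- Instantiating at `x` itself under the double negation gives `~ ~ A`, hence `A`; `x` is not free
  -- in the antecedent, so it can be generalised.
  ∀-stable : ∀ {x A} → Stable A → Stable (all x A)
  ∀-stable {x} {A} st =
    ∀-intro (λ x∈ → proj₁ (~~-FreeIn (all x A) x∈) refl) (⊃-trans (~~-map (∀-elim x A)) st)

  ∧-stable : ∀ {A B} → Stable A → Stable B → Stable (A ∧ B)
  ∧-stable stA stB = closed (lam (pair
    (app (thm (⊃-trans (~~-map (axiom (∧-elim₁ _ _))) stA)) v0)
    (app (thm (⊃-trans (~~-map (axiom (∧-elim₂ _ _))) stB)) v0)))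

  -- For a given proof of `A`, evaluation sends `A ⊃ B` to the stable `B`, so it extends to
  -- `~ ~ (A ⊃ B)`.
  ⊃-stable : ∀ {A B} → Stable B → Stable (A ⊃ B)
  ⊃-stable st = closed (lam (lam (app (app (thm (~~-elim st)) (lam (app v0 v1))) v1)))

  ⟦⟧-stable : (p : Form mixed proposition) → Stable ⟦ p ⟧
  ⟦⟧-stable (atom P ts) = ~-stable
  ⟦⟧-stable falsum      = closed (lam (app v0 (lam v0)))
  ⟦⟧-stable (p ∧ q)     = ∧-stable (⟦⟧-stable p) (⟦⟧-stable q)
  ⟦⟧-stable (p ∨ q)     = ~-stable
  ⟦⟧-stable (p ⊃ q)     = ⊃-stable (⟦⟧-stable q)
  ⟦⟧-stable (all x p)   = ∀-stable (⟦⟧-stable p)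
  ⟦⟧-stable (ex x p)    = ~-stable
  ⟦⟧-stable (¿ α)       = ~-stable

  close-intro : ∀ s {A} → Γ ⊢QH A ⊃ close s A
  close-intro problem     = closed (lam v0)
  close-intro proposition = ~~-intro

  -- The target shares the sort `s`: wherever `close s` adds negations, `⟦ B ⟧` translates a
  -- proposition and is stable.
  close-elim : ∀ s {A} (B : Form mixed s) → Γ ⊢QH (A ⊃ ⟦ B ⟧) ⊃ close s A ⊃ ⟦ B ⟧
  close-elim problem     B = closed (lam v0)
  close-elim proposition B = ~~-elim (⟦⟧-stable B)

  -- Soundness of the translation

  int-sound : ∀ {s} {A : Form mixed s} → IntAxiom A → Γ ⊢QH ⟦ A ⟧
  int-sound (K A B)       = axiom (K _ _)
  int-sound (S A B C)     = axiom (S _ _ _)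
  int-sound (∧-intro A B) = axiom (∧-intro _ _)
  int-sound (∧-elim₁ A B) = axiom (∧-elim₁ _ _)
  int-sound (∧-elim₂ A B) = axiom (∧-elim₂ _ _)
  int-sound {s} (∨-intro₁ A B) = ⊃-trans (axiom (∨-intro₁ _ _)) (close-intro s)
  int-sound {s} (∨-intro₂ A B) = ⊃-trans (axiom (∨-intro₂ _ _)) (close-intro s)
  int-sound {s} (∨-elim A B C) = closed (lam (lam
    (app (thm (close-elim s C)) (app (app (thm (axiom (∨-elim _ _ _))) v1) v0))))
  int-sound (ex-falso A)  = axiom (ex-falso _)
  int-sound (∀-inst x t A free) rewrite ⟦⟧-[≔] x t A =
    axiom (∀-inst x t ⟦ A ⟧ (⟦⟧-FreeFor A free))
  int-sound {s} (∃-wit x t A free) rewrite ⟦⟧-[≔] x t A =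
    ⊃-trans (axiom (∃-wit x t ⟦ A ⟧ (⟦⟧-FreeFor A free))) (close-intro s)
  int-sound (∀-dist x A B x∉B) = axiom (∀-dist x ⟦ A ⟧ ⟦ B ⟧ (x∉B ∘ ⟦⟧-FreeIn B))
  int-sound {s} (∃-dist x A B x∉B) =
    ⊃-trans (axiom (∃-dist x ⟦ A ⟧ ⟦ B ⟧ (x∉B ∘ ⟦⟧-FreeIn B))) (close-elim s B)

  axiom-sound : ∀ {s} {A : Form mixed s} → QHCAxiom A → Γ ⊢QH ⟦ A ⟧
  axiom-sound (int a)      = int-sound a
  -- The classical `∨` makes the goal the double negation of excluded middle, which holds
  -- intuitionistically.
  axiom-sound (lem p)      = closed (lam (app v0 (inr (lam (app v1 (inl v0))))))
  -- With `!` erased, this schema says precisely that `⟦ p ⟧` is stable.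
  axiom-sound (¿!-elim p)  = ⟦⟧-stable p
  axiom-sound (!¿-intro α) = ~~-intro
  axiom-sound (!-⊃ p q)    = closed (lam v0)
  -- The goal `~ ~ ⟦ β ⟧` is a negation, so both antecedents may shed their double negations.
  axiom-sound (¿-⊃ α β)    = closed (lam (lam (app
    (app (thm (~~-elim ~-stable)) (lam (app (app (thm (~~-elim ~-stable))
      (lam (app (thm ~~-intro) (app v1 v0)))) v1))) v1)))
  axiom-sound !-0          = closed (lam v0)
  axiom-sound (¿-∧ α β)    = ∧-intro-⊢
    (closed (lam (pair (app (thm (~~-map (axiom (∧-elim₁ _ _)))) v0)
                       (app (thm (~~-map (axiom (∧-elim₂ _ _)))) v0))))
    (closed (lam (app (app (thm (~~-elim ~-stable))
      (lam (app (app (thm (~~-elim ~-stable)) (lam (app (thm ~~-intro) (pair v1 v0)))) (snd v1))))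
      (fst v0))))
  -- The right side reads `~ ~ (~ ~ ⟦ α ⟧ ∨ ~ ~ ⟦ β ⟧)`; the outer negations make the forward
  -- implication intuitionistically valid. The same happens for `ex` in `¿-∃`.
  axiom-sound (¿-∨ α β)    = ∧-intro-⊢
    (~~-map (mp (mp (axiom (∨-elim _ _ _)) (⊃-trans ~~-intro (axiom (∨-intro₁ _ _))))
                (⊃-trans ~~-intro (axiom (∨-intro₂ _ _)))))
    (mp (~~-elim ~-stable) (mp (mp (axiom (∨-elim _ _ _)) (~~-map (axiom (∨-intro₁ _ _))))
                               (~~-map (axiom (∨-intro₂ _ _)))))
  axiom-sound ¿-⊥          = closed (lam (app v0 (lam v0)))
  axiom-sound (¿-∃ x α)    = ∧-intro-⊢
    (~~-map (∃-elim (λ (x≢x , _) → x≢x refl) (⊃-trans ~~-intro (∃-intro x _))))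
    (mp (~~-elim ~-stable)
      (∃-elim (λ x∈ → proj₁ (~~-FreeIn (ex x ⟦ α ⟧) x∈) refl) (~~-map (∃-intro x _))))
  axiom-sound (¿-∀ x α)    =
    ∀-intro (λ x∈ → proj₁ (~~-FreeIn (all x ⟦ α ⟧) x∈) refl) (~~-map (∀-elim x _))

  -- Each rule is matched by a derivation from the same Γ: `!-rule` disappears, `¿-rule` becomes
  -- `~~-intro`, and `gen` stays `gen`, since both calculi let it act on formulas depending on
  -- premises.
  sound : ∀ {s} {A : Form mixed s} → embedAll Γ ⊢QHC A → Γ ⊢QH ⟦ A ⟧
  sound (premise A∈) with ∈-map⁻ _ A∈
  ... | β , β∈Γ , refl = subst (Γ ⊢QH_) (sym (⟦embed⟧ β)) (premise β∈Γ)
  sound (axiom a)  = axiom-sound a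
  sound (mp d e)   = mp (sound d) (sound e)
  sound (gen x d)  = gen x (sound d)
  sound (!-rule d) = sound d
  sound (¿-rule d) = mp ~~-intro (sound d)

theorem3p5 : (Γ : List (Form plain problem)) (α : Form plain problem) →
    embedAll Γ ⊢QHC embed α → Γ ⊢QH α
theorem3p5 Γ α d = subst (Γ ⊢QH_) (⟦embed⟧ α) (sound d)
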